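{- Let $G$ be a connected graph cellularly embedded on an orientable closed surface of genus $h\geq 0$. If $G$ has an even number of edges and has a perfect matching, then the total resonance graph $R_t(G)$ is bipartite.
   Context: A perfect matching of $G$ is a set of edges covering every vertex exactly once. A face of the embedding whose boundary is a cycle is said to have a facial cycle. The total resonance graph $R_t(G)$ has as vertices the perfect matchings of $G$, and two perfect matchings $M_1,M_2$ are adjacent if and only if the symmetric difference $M_1\oplus M_2=(M_1\setminus M_2)\cup(M_2\setminus M_1)$ is exactly the edge set of one facial cycle of $G$ (i.e. $M_2$ is obtained from $M_1$ by rotating along an $M_1$-alternating facial cycle). -}

module Defs where

open import Level using (0ℓ)
open import Data.Bool using (Bool; not)
open import Data.Fin using (Fin)
open import Data.Fin.Subset using (Subset; _∈_; _∪_; _─_)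
open import Data.Nat using (ℕ; _+_; _∸_; ⌊_/2⌋)
open import Data.Nat.GeneralisedArithmetic using (fold)
open import Data.Product using (Σ-syntax; ∃; ∃-syntax; ∃!; _×_; _,_; proj₁)
open import Function using (_⇔_; _↔_; Inverse; Surjective)
open import Relation.Binary using (Rel)
open import Relation.Binary.Construct.Closure.ReflexiveTransitive using (Star)
open import Relation.Binary.PropositionalEquality using (_≡_; _≢_)

-- Finite undirected graphs; loops and parallel edges are allowed.  The
-- order in which the two ends of an edge are listed carries no meaning.
record Graph : Set where
  field
    #V #E : ℕ
    end   : Fin #E → Bool → Fin #V

  Vertex Edge : Set
  Vertex = Fin #V
  Edge   = Fin #E

  -- A dart is an edge together with a direction of travel, given by
  -- the end from which it departs.
  Dart : Set
  Dart = Edge × Bool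

  edge : Dart → Edge
  edge = proj₁

  reverse : Dart → Dart
  reverse (e , b) = e , not b

  tail head : Dart → Vertex
  tail (e , b) = end e b
  head d       = tail (reverse d)

  Adjacent : Rel Vertex 0ℓ
  Adjacent u v = Σ[ d ∈ Dart ] (tail d ≡ u × head d ≡ v)

  -- The graph without vertices does not count as connected.
  Connected : Set
  Connected = Vertex × (∀ u v → Star Adjacent u v)

  -- Counting darts rather than edges at v keeps loops out of M: both
  -- darts of a loop depart from the same vertex.
  IsPerfectMatching : Subset #E → Set
  IsPerfectMatching M = ∀ v → ∃! _≡_ λ d → tail d ≡ v × edge d ∈ M

  -- Irrelevance makes two perfect matchings equal as soon as they
  -- consist of the same edges.
  record PerfectMatching : Set where
    field
      edges      : Subset #E
      .isPerfect : IsPerfectMatching edges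

-- Cellular embeddings of a connected graph in oriented closed surfaces,
-- up to homeomorphism, are the rotation systems of the graph: a
-- permutation of the darts which permutes the darts departing from each
-- vertex in a single cycle (their cyclic order around the vertex).
record CellularEmbedding (G : Graph) : Set where
  open Graph G
  field
    rotation : Dart ↔ Dart

  next : Dart → Dart
  next = Inverse.to rotation

  field
    next-tail   : ∀ d → tail (next d) ≡ tail d
    next-cyclic : ∀ d d′ → tail d ≡ tail d′ → ∃[ k ] fold d next k ≡ d′

  -- Face tracing: traverse the dart, then leave its head along the dart
  -- following the one of arrival.  The faces are the orbits.
  trace : Dart → Dart
  trace d = next (reverse d)

  -- x lies on the boundary walk of the face to which d belongs.
  OnFaceOf : Dart → Dart → Set
  OnFaceOf d x = ∃[ k ] fold d trace k ≡ x

  -- The boundary walk of the face of d is a cycle: it repeats neither a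
  -- vertex nor an edge.  (The second condition excludes the walk going
  -- back and forth along the only edge of K₂.)
  IsFacialCycle : Dart → Set
  IsFacialCycle d = ∀ {x y} → OnFaceOf d x → OnFaceOf d y →
    (tail x ≡ tail y → x ≡ y) × (edge x ≡ edge y → x ≡ y)

  record FaceCount (f : ℕ) : Set where
    field
      faceOf     : Dart → Fin f
      surjective : Surjective _≡_ _≡_ faceOf
      sameFace   : ∀ d x → (faceOf d ≡ faceOf x) ⇔ OnFaceOf d x

  -- Euler's formula #V − #E + f = 2 − 2h solved for h.  Neither the
  -- subtraction nor the division truncates for connected graphs with at
  -- least one edge, but that is not presupposed here.  (A one-vertex graph
  -- without edges has no darts, hence f = 0 instead of 1; its h is still 0.)
  HasGenus : ℕ → Set
  HasGenus h = ∃[ f ] (FaceCount f × h ≡ ⌊ (2 + #E) ∸ (#V + f) /2⌋)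

  _⊕_ : Subset #E → Subset #E → Subset #E
  M₁ ⊕ M₂ = (M₁ ─ M₂) ∪ (M₂ ─ M₁)

  -- The adjacency relation of the total resonance graph.
  TotalResonance : Rel PerfectMatching 0ℓ
  TotalResonance P₁ P₂ = Σ[ d ∈ Dart ] (IsFacialCycle d ×
    (∀ e → (e ∈ edges P₁ ⊕ edges P₂) ⇔ (∃[ x ] (OnFaceOf d x × edge x ≡ e))))
    where open PerfectMatching

-- The graph with vertex set V and adjacency relation _~_ is bipartite.
Bipartite : {V : Set} → Rel V 0ℓ → Set
Bipartite {V} _~_ = Σ[ side ∈ (V → Bool) ] (∀ {x y} → x ~ y → side x ≢ side y)

{-# OPTIONS --safe #-}
module Submission where

-- It suffices to find a set T of edges that every facial boundary walk meets
-- an odd number of times: the parity of |M ∩ T| then changes with every facial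
-- rotation of M.
--
-- Give the darts weights in 𝔽₂.  The weight 1 on the darts of a perfect matching
-- has sum 1 over every orbit of next.  Precomposing next with the reversal of one
-- edge after the other turns it into trace; each reversal merges or splits
-- orbits, and flipping the weight of exactly one of the two darts involved keeps
-- all orbit sums equal to 1.  The result is a Kasteleyn orientation: sum 1 around
-- every face, and the two darts of each edge have different weights.  Add 1 to
-- the weight of one dart of each edge to obtain a set of edges; this disturbs
-- the face sums in #E places, and a dual path from each of them to a fixed root
-- repairs them, the root itself being hit #E ≡ 0 times.

open import Defs
open import Algebra.Bundles using (CommutativeRing)
open import Level using (0ℓ)
open import Data.Bool using (Bool; true; false; not; _∧_; _xor_)
open import Data.Bool.Properties
  using (xor-∧-commutativeRing; xor-identityʳ; xor-assoc; xor-same; xor-comm; not-injective; ¬-not;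
         ∧-zeroʳ; ∧-identityʳ; ∧-distribˡ-xor; ∧-distribʳ-xor)
open import Data.Fin as Fin using (Fin; zero; suc; toℕ; fromℕ<)
open import Data.Fin.Properties
  using (inj⇒≟; any?; pigeonhole; toℕ-fromℕ<; toℕ<n; toℕ-injective; 2↔Bool; *↔×)
open import Data.Fin.Subset using (Subset; _∈_; _∪_; _─_)
open import Data.Nat using (ℕ; zero; suc; _+_; _*_; _≤_; _<_; z≤n; s≤s; _<?_)
open import Data.Nat.Divisibility using (_∣_; divides)
open import Data.Nat.GeneralisedArithmetic using (fold; fold-+)
open import Data.Nat.Properties
  using (m≤n⇒m<n∨m≡n; m≤n⇒∃[o]m+o≡n; +-suc; ≤-refl; ≤-reflexive; n<1+n; m<n⇒m<1+n;
         m<1+n⇒m<n∨m≡n; <-irrefl; <⇒≤)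
open import Data.Product using (∃; ∃-syntax; _×_; _,_; proj₁; proj₂)
open import Data.Product.Function.NonDependent.Propositional using (_×-↔_)
open import Data.Vec using (_∷_; lookup)
open import Data.Vec.Properties using ([]=⇒lookup; lookup⇒[]=)
open import Data.Sum using (_⊎_; inj₁; inj₂; [_,_]′)
open import Function using (_∘_; _↣_; _⇔_; mk⇔; mk↣; Injection; Equivalence; case_of_)
open import Function.Definitions using (Injective)
open import Function.Properties.Inverse using (↔⇒↣; ↔-refl; ↔-sym; ↔-trans)
open import Relation.Binary using (Rel; DecidableEquality)
open import Relation.Binary.Construct.Closure.ReflexiveTransitive using (Star; ε; _◅_)
open import Relation.Binary.PropositionalEquality
open import Relation.Nullary using (¬_; Dec; yes; no; does; contradiction)
open import Relation.Nullary.Decidable using (map′; dec-true; dec-false; does-⇔)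

open import Algebra.Properties.Semiring.Sum (CommutativeRing.semiring xor-∧-commutativeRing)
  using (sum; sum-cong-≗; sum-replicate-zero; ∑-distrib-+)

-- Orbits of a self-map

Orbit : {A : Set} → (A → A) → Rel A 0ℓ
Orbit π x y = ∃[ k ] fold x π k ≡ y

module _ {A : Set} where

  orbit-trans : (π : A → A) {x y z : A} → Orbit π x y → Orbit π y z → Orbit π x z
  orbit-trans π {x} (k , refl) (l , refl) = l + k , fold-+ x π l

  orbit-least : (π : A → A) (_~_ : Rel A 0ℓ) → (∀ {x} → x ~ x) →
    (∀ {x y} → x ~ y → x ~ π y) → ∀ {x y} → Orbit π x y → x ~ y
  orbit-least π _~_ ~-refl ~-step (zero , refl)  = ~-refl
  orbit-least π _~_ ~-refl ~-step (suc k , refl) =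
    ~-step (orbit-least π _~_ ~-refl ~-step (k , refl))

  orbit-cong : {π ρ : A → A} → (∀ x → π x ≡ ρ x) → ∀ {x y} → Orbit π x y → Orbit ρ x y
  orbit-cong {π} {ρ} π≗ρ {x} = orbit-least π (Orbit ρ) (0 , refl)
    λ {_} {y} (k , eq) → suc k , trans (cong ρ eq) (sym (π≗ρ y))

  -- An exponent that would reach `suc n` wraps round to 0, because the walk is then back at `x`.
  orbit-bounded : (π : A → A) (x : A) (n : ℕ) → fold x π (suc n) ≡ x →
    ∀ {y} → Orbit π x y → ∃[ i ] (i ≤ n × fold x π i ≡ y)
  orbit-bounded π x n period (zero , eq) = 0 , z≤n , eq
  orbit-bounded π x n period (suc k , refl)
    with orbit-bounded π x n period (k , refl)
  ... | i , i≤n , eq with m≤n⇒m<n∨m≡n i≤n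
  ...   | inj₁ i<n  = suc i , i<n , cong π eq
  ...   | inj₂ refl = 0 , z≤n , trans (sym period) (cong π eq)

  fold-step : (π : A → A) (x : A) (k : ℕ) → fold (π x) π k ≡ fold x π (suc k)
  fold-step π x zero    = refl
  fold-step π x (suc k) = cong π (fold-step π x k)

-- Permutations that differ by a transposition

record Swapped {A : Set} (π π′ : A → A) (a b : A) : Set where
  field
    at-a  : π′ a ≡ π b
    at-b  : π′ b ≡ π a
    fixed : ∀ x → x ≢ a → x ≢ b → π′ x ≡ π x

swapped-sym : {A : Set} {π π′ : A → A} {a b : A} → Swapped π π′ a b → Swapped π′ π a b
swapped-sym s = record
  { at-a  = sym at-b
  ; at-b  = sym at-a
  ; fixed = λ x x≢a x≢b → sym (fixed x x≢a x≢b)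
  } where open Swapped s

swapped-comm : {A : Set} {π π′ : A → A} {a b : A} → Swapped π π′ a b → Swapped π π′ b a
swapped-comm s = record
  { at-a  = at-b
  ; at-b  = at-a
  ; fixed = λ x x≢b x≢a → fixed x x≢a x≢b
  } where open Swapped s

module FinitePermutation {A : Set} {N : ℕ} (code : A ↣ Fin N) where
  open Injection using (to; injective)

  _≟_ : DecidableEquality A
  _≟_ = inj⇒≟ code

  module _ (π↣ : A ↣ A) where
    private
      π = to π↣

    fold-cancel : ∀ x i k → fold x π i ≡ fold x π (i + k) → x ≡ fold x π k
    fold-cancel x zero    k eq = eq
    fold-cancel x (suc i) k eq = fold-cancel x i k (injective π↣ eq)

    -- Among `N + 1` iterates two coincide by the pigeonhole principle, and injectivity cancels the
    -- steps they have in common.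
    period : ∀ x → ∃[ n ] fold x π (suc n) ≡ x
    period x with pigeonhole (n<1+n N) (λ i → to code (fold x π (toℕ i)))
    ... | i , j , i<j , eq with m≤n⇒∃[o]m+o≡n i<j
    ...   | k , i+k≡j = k , sym (fold-cancel x (toℕ i) (suc k)
              (trans (injective code eq) (cong (fold x π) (sym (trans (+-suc (toℕ i) k) i+k≡j)))))

    abstract
      -- A full period exhausts the orbit, so a bounded search decides; opaque, lest the search be
      -- unfolded.
      orbit? : ∀ x y → Dec (Orbit π x y)
      orbit? x y with period x
      ... | n , per = map′
        (λ (i , eq) → toℕ i , eq)
        (λ o → let i , i≤n , eq = orbit-bounded π x n per o in
          fromℕ< (s≤s i≤n) , trans (cong (fold x π) (toℕ-fromℕ< (s≤s i≤n))) eq)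
        (any? λ (i : Fin (suc n)) → fold x π (toℕ i) ≟ y)

    orbit-sym : ∀ {x y} → Orbit π x y → Orbit π y x
    orbit-sym = orbit-least π (λ x y → Orbit π y x) (0 , refl)
      λ {_} {y} → orbit-trans π (back y)
      where
      back : ∀ y → Orbit π (π y) y
      back y = let n , per = period y in n , trans (fold-step π y n) per

  -- Follow b, πb, π²b, … up to the first return to {a, b}; up to there, the
  -- π′-walk from a runs through the same elements.
  separates-or-joins : (π π′ : A ↣ A) {a b : A} → a ≢ b → Swapped (to π) (to π′) a b →
    (Orbit (to π) a b × ¬ Orbit (to π′) a b) ⊎ (¬ Orbit (to π) a b × Orbit (to π′) a b)
  separates-or-joins π↣ π′↣ {a} {b} a≢b swap = result
    where
    open Swapped swap
    π = to π↣
    π′ = to π′↣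

    Avoids : ℕ → Set
    Avoids m = ∀ i → i < m → fold b π (suc i) ≢ a × fold b π (suc i) ≢ b

    search : ∀ m → Avoids m ⊎
      ∃[ j ] (Avoids j × (fold b π (suc j) ≡ a ⊎ fold b π (suc j) ≡ b))
    search zero = inj₁ λ _ ()
    search (suc m) with search m
    ... | inj₂ hit = inj₂ hit
    ... | inj₁ avoids with fold b π (suc m) ≟ a | fold b π (suc m) ≟ b
    ...   | yes eq | _      = inj₂ (m , avoids , inj₁ eq)
    ...   | no _   | yes eq = inj₂ (m , avoids , inj₂ eq)
    ...   | no ≢a  | no ≢b  = inj₁ λ i i<1+m → case m<1+n⇒m<n∨m≡n i<1+m of λ where
      (inj₁ i<m)  → avoids i i<m
      (inj₂ refl) → ≢a , ≢b

    firstReturn : ∃[ j ] (Avoids j × (fold b π (suc j) ≡ a ⊎ fold b π (suc j) ≡ b))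
    firstReturn with period π↣ b
    ... | n , per with search (suc n)
    ...   | inj₂ hit    = hit
    ...   | inj₁ avoids = contradiction per (proj₂ (avoids n (n<1+n n)))

    parallel : ∀ j → Avoids j → ∀ i → i ≤ j → fold a π′ (suc i) ≡ fold b π (suc i)
    parallel j avoids zero    _   = at-a
    parallel j avoids (suc i) i<j = trans (cong π′ (parallel j avoids i (<⇒≤ i<j)))
      (let ≢a , ≢b = avoids i i<j in fixed _ ≢a ≢b)

    result : (Orbit π a b × ¬ Orbit π′ a b) ⊎ (¬ Orbit π a b × Orbit π′ a b)
    result with firstReturn
    -- The walk meets `a` first, so `a` and `b` share a `π`-orbit; the `π′`-walk from `a` closes up
    -- at `a` without meeting `b`.
    ... | j , avoids , inj₁ atA = inj₁ (orbit-sym π↣ (suc j , atA) , λ o →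
      case orbit-bounded π′ a j (trans (parallel j avoids j ≤-refl) atA) o of λ where
        (zero , _ , eq)    → a≢b eq
        (suc i , i<j , eq) → proj₂ (avoids i i<j)
          (trans (sym (parallel j avoids i (<⇒≤ i<j))) eq))
    -- The walk returns to `b` first: its `π`-orbit misses `a`, and the parallel `π′`-walk leads
    -- from `a` to `b`.
    ... | j , avoids , inj₂ atB = inj₂ ((λ o →
      case orbit-bounded π b j atB (orbit-sym π↣ o) of λ where
        (zero , _ , eq)    → a≢b (sym eq)
        (suc i , i<j , eq) → proj₁ (avoids i i<j) eq)
      , suc j , trans (parallel j avoids j ≤-refl) atB)

  -- Read in 𝔽₂, `χ π x` is the indicator vector of an orbit; pairing a weight with it gives the
  -- orbit sum.
  χ : A ↣ A → A → A → Bool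
  χ π x y = does (orbit? π x y)

  χ-orbit : (π : A ↣ A) {x z : A} → Orbit (to π) x z → ∀ y → χ π x y ≡ χ π z y
  χ-orbit π {x} {z} o y = does-⇔
    (mk⇔ (orbit-trans (to π) (orbit-sym π o)) (orbit-trans (to π) o))
    (orbit? π x y) (orbit? π z y)

  -- Splitting is merging read backwards, so this module also serves `split-sum` and `odd-split`,
  -- with the two permutations exchanged.
  module Merge (π↣ π′↣ : A ↣ A) {a b : A} (swap : Swapped (to π↣) (to π′↣) a b)
               (apart : ¬ Orbit (to π↣) a b) (joined : Orbit (to π′↣) a b) where
    private
      π = to π↣
      π′ = to π′↣
    open Swapped swap

    orbit-grows : ∀ {x y} → Orbit π x y → Orbit π′ x y
    orbit-grows = orbit-least π (Orbit π′) (0 , refl) λ {_} {y} o → orbit-trans π′ o (step y)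
      where
      step : ∀ y → Orbit π′ y (π y)
      step y with y ≟ a | y ≟ b
      ... | yes refl | _ = orbit-trans π′ joined (1 , at-b)
      ... | no _ | yes refl = orbit-trans π′ (orbit-sym π′↣ joined) (1 , at-a)
      ... | no ≢a | no ≢b = 1 , fixed y ≢a ≢b

    Near : A → Set
    Near x = Orbit π a x ⊎ Orbit π b x

    near-step : ∀ {x} → Near x → Near (π x)
    near-step (inj₁ o) = inj₁ (orbit-trans π o (1 , refl))
    near-step (inj₂ o) = inj₂ (orbit-trans π o (1 , refl))

    -- The two maps differ only at `a` and `b`, where `π′` crosses between the two `π`-orbits
    -- gathered in `Near`.
    orbit-merged : ∀ {x y} → Orbit π′ x y → Orbit π x y ⊎ (Near x × Near y)
    orbit-merged = orbit-least π′ (λ x y → Orbit π x y ⊎ (Near x × Near y))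
      (inj₁ (0 , refl)) λ {x} {y} → step x y
      where
      step : ∀ x y → Orbit π x y ⊎ (Near x × Near y) →
        Orbit π x (π′ y) ⊎ (Near x × Near (π′ y))
      step x y r with y ≟ a | y ≟ b
      ... | yes refl | _ = inj₂ ([ inj₁ ∘ orbit-sym π↣ , proj₁ ]′ r , inj₂ (1 , sym at-a))
      ... | no _ | yes refl = inj₂ ([ inj₂ ∘ orbit-sym π↣ , proj₁ ]′ r , inj₁ (1 , sym at-b))
      ... | no ≢a | no ≢b rewrite fixed y ≢a ≢b = case r of λ where
        (inj₁ o)         → inj₁ (orbit-trans π o (1 , refl))
        (inj₂ (nx , ny)) → inj₂ (nx , near-step ny)

    χ-outside : ∀ {x} → ¬ Orbit π′ x a → ∀ y → χ π′↣ x y ≡ χ π↣ x y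
    χ-outside {x} away y = does-⇔ (mk⇔ shrink orbit-grows) (orbit? π′↣ x y) (orbit? π↣ x y)
      where
      shrink : Orbit π′ x y → Orbit π x y
      shrink o with orbit-merged o
      ... | inj₁ o′ = o′
      ... | inj₂ (inj₁ ax , _) = contradiction (orbit-sym π′↣ (orbit-grows ax)) away
      ... | inj₂ (inj₂ bx , _) = contradiction
        (orbit-sym π′↣ (orbit-trans π′ joined (orbit-grows bx))) away

    -- The merged orbit is the disjoint union of the `π`-orbits of `a` and `b`, so the indicators
    -- add in 𝔽₂.
    χ-inside : ∀ {x} → Orbit π′ x a → ∀ y → χ π′↣ x y ≡ χ π↣ a y xor χ π↣ b y
    χ-inside {x} xa y with orbit? π↣ a y | orbit? π↣ b y
    ... | yes ay | yes by = contradiction (orbit-trans π ay (orbit-sym π↣ by)) apart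
    ... | yes ay | no _   = dec-true (orbit? π′↣ x y) (orbit-trans π′ xa (orbit-grows ay))
    ... | no _   | yes by = dec-true (orbit? π′↣ x y)
      (orbit-trans π′ xa (orbit-trans π′ joined (orbit-grows by)))
    ... | no ¬ay | no ¬by = dec-false (orbit? π′↣ x y) λ xy →
      case orbit-merged (orbit-trans π′ (orbit-sym π′↣ xa) xy) of λ where
        (inj₁ ay)            → ¬ay ay
        (inj₂ (_ , inj₁ ay)) → ¬ay ay
        (inj₂ (_ , inj₂ by)) → ¬by by

-- Sums and pairings over 𝔽₂

open CommutativeRing xor-∧-commutativeRing using (+-commutativeSemigroup)
open import Algebra.Properties.CommutativeSemigroup +-commutativeSemigroup
  using () renaming (interchange to xor-interchange)

sum-single : ∀ {n} (h : Fin n → Bool) i → (∀ j → j ≢ i → h j ≡ false) → sum h ≡ h i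
sum-single {suc n} h zero    z = trans
  (cong (h zero xor_) (trans (sum-cong-≗ {n} λ j → z (suc j) λ ()) (sum-replicate-zero n)))
  (xor-identityʳ (h zero))
sum-single {suc n} h (suc i) z = trans
  (cong (_xor sum (h ∘ suc)) (z zero λ ()))
  (sum-single (h ∘ suc) i λ j j≢i → z (suc j) λ { refl → j≢i refl })

sum-const-even : ∀ {n} → 2 ∣ n → ∀ c → sum {n} (λ _ → c) ≡ false
sum-const-even (divides q refl) c = go q
  where
  go : ∀ q → sum {q * 2} (λ _ → c) ≡ false
  go zero    = refl
  go (suc q) = trans (sym (xor-assoc c c _)) (trans (cong (_xor sum {q * 2} (λ _ → c)) (xor-same c)) (go q))

module DartSums (n : ℕ) where

  D : Set
  D = Fin n × Bool

  D↣Fin : D ↣ Fin (n * 2)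
  D↣Fin = ↔⇒↣ (↔-trans (↔-refl ×-↔ ↔-sym 2↔Bool) (↔-sym *↔×))

  open FinitePermutation D↣Fin public

  -- Grouping the two darts of each edge lets sums over darts pass to sums over edges, as in
  -- `·-edgewise`.
  total : (D → Bool) → Bool
  total h = sum λ e → h (e , false) xor h (e , true)

  total-cong : ∀ {g h} → (∀ x → g x ≡ h x) → total g ≡ total h
  total-cong g≗h = sum-cong-≗ λ e → cong₂ _xor_ (g≗h (e , false)) (g≗h (e , true))

  total-xor : ∀ g h → total (λ x → g x xor h x) ≡ total g xor total h
  total-xor g h = trans
    (sum-cong-≗ λ e → xor-interchange (g (e , false)) (h (e , false)) (g (e , true)) (h (e , true)))
    (∑-distrib-+ (λ e → g (e , false) xor g (e , true)) (λ e → h (e , false) xor h (e , true)))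

  total-single : ∀ h d → (∀ x → x ≢ d → h x ≡ false) → total h ≡ h d
  total-single h (i , b) z = trans (sum-single _ i elsewhere) (here b z)
    where
    elsewhere : ∀ j → j ≢ i → h (j , false) xor h (j , true) ≡ false
    elsewhere j j≢i = cong₂ _xor_ (z (j , false) (j≢i ∘ cong proj₁)) (z (j , true) (j≢i ∘ cong proj₁))

    here : ∀ b → (∀ x → x ≢ (i , b) → h x ≡ false) →
      h (i , false) xor h (i , true) ≡ h (i , b)
    here false z = trans (cong (h (i , false) xor_) (z (i , true) λ ())) (xor-identityʳ _)
    here true  z = cong (_xor h (i , true)) (z (i , false) λ ())

  infix 8 _·_
  _·_ : (D → Bool) → (D → Bool) → Bool
  f · g = total λ x → f x ∧ g x

  infixl 7 _⊞_
  _⊞_ : (D → Bool) → (D → Bool) → D → Bool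
  (f ⊞ g) x = f x xor g x

  δ : D → D → Bool
  δ x y = does (x ≟ y)

  ·-congˡ : ∀ f {g h} → (∀ x → g x ≡ h x) → f · g ≡ f · h
  ·-congˡ f g≗h = total-cong λ x → cong (f x ∧_) (g≗h x)

  ·-congʳ : ∀ {f g} h → (∀ x → f x ≡ g x) → f · h ≡ g · h
  ·-congʳ h f≗g = total-cong λ x → cong (_∧ h x) (f≗g x)

  ·-distribˡ : ∀ f g h → f · (g ⊞ h) ≡ f · g xor f · h
  ·-distribˡ f g h = trans (total-cong λ x → ∧-distribˡ-xor (f x) (g x) (h x))
    (total-xor (λ x → f x ∧ g x) (λ x → f x ∧ h x))

  ·-distribʳ : ∀ f g h → (f ⊞ g) · h ≡ f · h xor g · h
  ·-distribʳ f g h = trans (total-cong λ x → ∧-distribʳ-xor (h x) (f x) (g x))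
    (total-xor (λ x → f x ∧ h x) (λ x → g x ∧ h x))

  ·-zero : ∀ f → f · (λ _ → false) ≡ false
  ·-zero f = trans (total-cong λ x → ∧-zeroʳ (f x)) (sum-replicate-zero n)

  ·-δ : ∀ f d → f · δ d ≡ f d
  ·-δ f d = trans
    (total-single _ d λ x x≢d → trans (cong (f x ∧_) (dec-false (d ≟ x) (x≢d ∘ sym))) (∧-zeroʳ (f x)))
    (trans (cong (f d ∧_) (dec-true (d ≟ d) refl)) (∧-identityʳ (f d)))

  ·-sum : ∀ {m} f (g : Fin m → D → Bool) → f · (λ x → sum λ i → g i x) ≡ sum λ i → f · g i
  ·-sum {zero}  f g = ·-zero f
  ·-sum {suc m} f g = trans (·-distribˡ f (g zero) (λ x → sum λ i → g (suc i) x))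
    (cong (f · g zero xor_) (·-sum f (g ∘ suc)))

  ·-edgewise : ∀ f (t : Fin n → Bool) →
    f · (t ∘ proj₁) ≡ sum λ e → (f (e , false) xor f (e , true)) ∧ t e
  ·-edgewise f t = sum-cong-≗ λ e → sym (∧-distribʳ-xor (t e) (f (e , false)) (f (e , true)))

  -- Odd orbit sums under a transposition

  OddOn : D ↣ D → (D → Bool) → Set
  OddOn π w = ∀ x → χ π x · w ≡ true

  -- Exactly one of a and b is chosen: after a merger of two odd orbits either
  -- will do, after a splitting it has to lie in the even part.
  module _ (π π′ : D ↣ D) {a b : D} (swap : Swapped (Injection.to π) (Injection.to π′) a b) where
    private
      ρ = Injection.to π
      ρ′ = Injection.to π′

    -- The merged orbit has sum 1 + 1 = 0 and contains `a`, whose flip restores 1; other orbits keep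
    -- their sums.
    odd-merge : ¬ Orbit ρ a b → Orbit ρ′ a b → ∀ w → OddOn π w → OddOn π′ (w ⊞ δ a)
    odd-merge apart joined w odd x = trans (·-distribˡ (χ π′ x) w (δ a)) (cases (orbit? π′ x a))
      where
      open Merge π π′ swap apart joined
      cases : Dec (Orbit ρ′ x a) → χ π′ x · w xor χ π′ x · δ a ≡ true
      cases (yes xa) = cong₂ _xor_
        (trans (·-congʳ w (χ-inside xa))
          (trans (·-distribʳ (χ π a) (χ π b) w) (cong₂ _xor_ (odd a) (odd b))))
        (trans (·-δ (χ π′ x) a) (dec-true (orbit? π′ x a) xa))
      cases (no ¬xa) = cong₂ _xor_
        (trans (·-congʳ w (χ-outside ¬xa)) (odd x))
        (trans (·-δ (χ π′ x) a) (dec-false (orbit? π′ x a) ¬xa))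

    -- The two parts make up an orbit of sum 1, so exactly one of them is even.
    split-sum : Orbit ρ a b → ¬ Orbit ρ′ a b → ∀ w → OddOn π w →
      χ π′ a · w xor χ π′ b · w ≡ true
    split-sum joined apart w odd = trans (sym (·-distribʳ (χ π′ a) (χ π′ b) w))
      (trans (sym (·-congʳ w (χ-inside (0 , refl)))) (odd a))
      where open Merge π′ π (swapped-sym swap) apart joined

    -- The flip at `a` repairs the even part, to which `a` belongs; the part of `b` is odd already.
    odd-split : Orbit ρ a b → ¬ Orbit ρ′ a b → ∀ w → OddOn π w →
      χ π′ a · w ≡ false → OddOn π′ (w ⊞ δ a)
    odd-split joined apart w odd even x =
      trans (·-distribˡ (χ π′ x) w (δ a)) (cases (orbit? π′ x a) (orbit? π′ x b))
      where
      open Merge π′ π (swapped-sym swap) apart joined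

      odd-b : χ π′ b · w ≡ true
      odd-b = trans (cong (_xor χ π′ b · w) (sym even)) (split-sum joined apart w odd)

      cases : Dec (Orbit ρ′ x a) → Dec (Orbit ρ′ x b) → χ π′ x · w xor χ π′ x · δ a ≡ true
      cases (yes xa) _ = cong₂ _xor_
        (trans (·-congʳ w (χ-orbit π′ xa)) even)
        (trans (·-δ (χ π′ x) a) (dec-true (orbit? π′ x a) xa))
      cases (no ¬xa) xb? = cong₂ _xor_ (odd-x xb?)
        (trans (·-δ (χ π′ x) a) (dec-false (orbit? π′ x a) ¬xa))
        where
        -- An orbit after the splitting that contains neither `a` nor `b` lies outside the orbit
        -- that was split, hence was an orbit before.
        away : ¬ Orbit ρ′ x b → ¬ Orbit ρ x a
        away ¬xb xa = case orbit-merged xa of λ where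
          (inj₁ xa′)           → ¬xa xa′
          (inj₂ (inj₁ ax , _)) → ¬xa (orbit-sym π′ ax)
          (inj₂ (inj₂ bx , _)) → ¬xb (orbit-sym π′ bx)

        odd-x : Dec (Orbit ρ′ x b) → χ π′ x · w ≡ true
        odd-x (yes xb) = trans (·-congʳ w (χ-orbit π′ xb)) odd-b
        odd-x (no ¬xb) = trans (sym (·-congʳ w (χ-outside (away ¬xb)))) (odd x)

  odd-swap : (π π′ : D ↣ D) {a b : D} → a ≢ b →
    Swapped (Injection.to π) (Injection.to π′) a b → ∀ w → OddOn π w →
    ∃[ c ] ((c ≡ a ⊎ c ≡ b) × OddOn π′ (w ⊞ δ c))
  odd-swap π π′ {a} {b} a≢b swap w odd with separates-or-joins π π′ a≢b swap
  ... | inj₂ (apart , joined) = a , inj₁ refl , odd-merge π π′ swap apart joined w odd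
  ... | inj₁ (joined , apart) with χ π′ a · w in eqa
  ...   | false = a , inj₁ refl , odd-split π π′ swap joined apart w odd eqa
  -- The part of `a` is odd, hence that of `b` even, and the two change places.
  ...   | true  = b , inj₂ refl , odd-split π π′ (swapped-comm swap)
    (orbit-sym π joined) (apart ∘ orbit-sym π′) w odd
    (not-injective (trans (cong (_xor χ π′ b · w) (sym eqa)) (split-sum π π′ swap joined apart w odd)))

  -- Kasteleyn orientation by reversing edge after edge

  below? : ℕ → Fin n → Bool
  below? k e = does (toℕ e <? k)

  module _ {k} (k<n : k < n) where
    private
      e = fromℕ< k<n

      toℕ-e : toℕ e ≡ k
      toℕ-e = toℕ-fromℕ< k<n

    below?-before : below? k e ≡ false
    below?-before = dec-false (toℕ e <? k) (<-irrefl toℕ-e)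

    below?-after : below? (suc k) e ≡ true
    below?-after = dec-true (toℕ e <? suc k) (s≤s (≤-reflexive toℕ-e))

    below?-other : ∀ e′ → e′ ≢ e → below? (suc k) e′ ≡ below? k e′
    below?-other e′ e′≢e =
      does-⇔ (mk⇔ shrink m<n⇒m<1+n) (toℕ e′ <? suc k) (toℕ e′ <? k)
      where
      shrink : toℕ e′ < suc k → toℕ e′ < k
      shrink lt = [ (λ e′<k → e′<k) ,
        (λ eq → contradiction (toℕ-injective (trans eq (sym toℕ-e))) e′≢e) ]′ (m<1+n⇒m<n∨m≡n lt)

  -- Interpolates between the identity at `k = 0` and the reversal of every dart at `k = n`.
  reverseBelow : ℕ → D → D
  reverseBelow k (e , b) = e , below? k e xor b

  reverseBelow-injective : ∀ k → Injective _≡_ _≡_ (reverseBelow k)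
  reverseBelow-injective k {e , b} {e′ , b′} eq with cong proj₁ eq
  ... | refl = cong (e ,_) (xor-cancelˡ (below? k e) (cong proj₂ eq))
    where
    xor-cancelˡ : ∀ s {b b′} → s xor b ≡ s xor b′ → b ≡ b′
    xor-cancelˡ false eq = eq
    xor-cancelˡ true  eq = not-injective eq

  χ-cong : (π π′ : D ↣ D) → (∀ x → Injection.to π x ≡ Injection.to π′ x) →
    ∀ x y → χ π x y ≡ χ π′ x y
  χ-cong π π′ π≗π′ x y = does-⇔ (mk⇔ (orbit-cong π≗π′) (orbit-cong (sym ∘ π≗π′)))
    (orbit? π x y) (orbit? π′ x y)

  module Kasteleyn (next↣ : D ↣ D) (w₀ : D → Bool) (odd₀ : OddOn next↣ w₀)
                   (w₀-edge : ∀ e → w₀ (e , false) xor w₀ (e , true) ≡ false) where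
    private
      next = Injection.to next↣

    stage : ℕ → D ↣ D
    stage k = mk↣ {to = next ∘ reverseBelow k}
      (reverseBelow-injective k ∘ Injection.injective next↣)

    -- The two stages differ by the reversal of edge number `k` alone, which is the transposition of
    -- its two darts.
    stage-swapped : ∀ {k} (k<n : k < n) → let e = fromℕ< k<n in
      Swapped (Injection.to (stage k)) (Injection.to (stage (suc k))) (e , false) (e , true)
    stage-swapped {k} k<n = record
      { at-a  = cong (λ b → next (e , b))
          (trans (cong (_xor false) (below?-after k<n)) (sym (cong (_xor true) (below?-before k<n))))
      ; at-b  = cong (λ b → next (e , b))
          (trans (cong (_xor true) (below?-after k<n)) (sym (cong (_xor false) (below?-before k<n))))
      ; fixed = λ (e′ , b) ≢a ≢b →
          cong (λ s → next (e′ , s xor b)) (below?-other k<n e′ (distinct b ≢a ≢b))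
      }
      where
      e : Fin n
      e = fromℕ< k<n
      distinct : ∀ {e′} b → (e′ , b) ≢ (e , false) → (e′ , b) ≢ (e , true) → e′ ≢ e
      distinct false ≢a ≢b refl = ≢a refl
      distinct true  ≢a ≢b refl = ≢b refl

    -- The induction invariant: the two darts agree, as under `w₀`, until their edge is reversed,
    -- and disagree from then on.
    Oriented : ℕ → (D → Bool) → Set
    Oriented k w = ∀ e → w (e , false) xor w (e , true) ≡ below? k e

    oriented-step : ∀ {k} (k<n : k < n) w c → proj₁ c ≡ fromℕ< k<n →
      Oriented k w → Oriented (suc k) (w ⊞ δ c)
    oriented-step {k} k<n w c c≡ oriented e = trans
      (xor-interchange (w (e , false)) (δ c (e , false)) (w (e , true)) (δ c (e , true)))
      (cases c c≡ (e Fin.≟ fromℕ< k<n))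
      where
      cases : ∀ c → proj₁ c ≡ fromℕ< k<n → Dec (e ≡ fromℕ< k<n) →
        (w (e , false) xor w (e , true)) xor (δ c (e , false) xor δ c (e , true)) ≡ below? (suc k) e
      cases (i , false) refl (yes refl) = trans
        (cong₂ _xor_ (trans (oriented e) (below?-before k<n))
          (cong₂ _xor_ (dec-true ((e , false) ≟ (e , false)) refl)
                       (dec-false ((e , false) ≟ (e , true)) λ ())))
        (sym (below?-after k<n))
      cases (i , true) refl (yes refl) = trans
        (cong₂ _xor_ (trans (oriented e) (below?-before k<n))
          (cong₂ _xor_ (dec-false ((e , true) ≟ (e , false)) λ ())
                       (dec-true ((e , true) ≟ (e , true)) refl)))
        (sym (below?-after k<n))
      cases c refl (no e≢i) = trans
        (cong₂ _xor_ (trans (oriented e) (sym (below?-other k<n e e≢i)))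
          (cong₂ _xor_ (dec-false (c ≟ (e , false)) λ { refl → e≢i refl })
                       (dec-false (c ≟ (e , true)) λ { refl → e≢i refl })))
        (xor-identityʳ (below? (suc k) e))

    orient : ∀ k → k ≤ n → ∃[ w ] (OddOn (stage k) w × Oriented k w)
    orient zero _ = w₀ ,
      (λ x → trans (·-congʳ w₀ (χ-cong (stage 0) next↣ (λ _ → refl) x)) (odd₀ x)) , w₀-edge
    orient (suc k) k<n =
      let w , odd , oriented = orient k (<⇒≤ k<n)
          c , c≡ , odd′ = odd-swap (stage k) (stage (suc k)) (λ ()) (stage-swapped k<n) w odd
      in w ⊞ δ c , odd′ , oriented-step k<n w c ([ cong proj₁ , cong proj₁ ]′ c≡) oriented

    -- At stage `n` every edge has been reversed, so `next` has become `trace`.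
    orientation : (trace↣ : D ↣ D) → (∀ e b → Injection.to trace↣ (e , b) ≡ next (e , not b)) →
      ∃[ w ] (OddOn trace↣ w × ∀ e → w (e , false) xor w (e , true) ≡ true)
    orientation trace↣ trace≡ =
      let w , odd , oriented = orient n ≤-refl in
      w , (λ x → trans (·-congʳ w (χ-cong trace↣ (stage n) agree x)) (odd x)) ,
      λ e → trans (oriented e) (all-below e)
      where
      all-below : ∀ e → below? n e ≡ true
      all-below e = dec-true (toℕ e <? n) (toℕ<n e)
      agree : ∀ x → Injection.to trace↣ x ≡ Injection.to (stage n) x
      agree (e , b) = trans (trace≡ e b) (cong (λ s → next (e , s xor b)) (sym (all-below e)))

-- The embedded graph: matchings and dual paths

lookup-⊕ : ∀ {n} (p q : Subset n) e → lookup ((p ─ q) ∪ (q ─ p)) e ≡ lookup p e xor lookup q e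
lookup-⊕ (false ∷ p) (false ∷ q) zero    = refl
lookup-⊕ (false ∷ p) (true ∷ q)  zero    = refl
lookup-⊕ (true ∷ p)  (false ∷ q) zero    = refl
lookup-⊕ (true ∷ p)  (true ∷ q)  zero    = refl
lookup-⊕ (_ ∷ p)     (_ ∷ q)     (suc e) = lookup-⊕ p q e

module Embedding (G : Graph) (S : CellularEmbedding G) where
  open Graph G
  open CellularEmbedding S
  open DartSums #E

  next↣ : Dart ↣ Dart
  next↣ = ↔⇒↣ rotation

  reverse-involutive : ∀ d → reverse (reverse d) ≡ d
  reverse-involutive (e , false) = refl
  reverse-involutive (e , true)  = refl

  trace↣ : Dart ↣ Dart
  trace↣ = mk↣ {to = trace} λ {x} {y} eq → trans (sym (reverse-involutive x))
    (trans (cong reverse (Injection.injective next↣ eq)) (reverse-involutive y))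

  vertex-orbit : ∀ {x y} → Orbit next x y → tail x ≡ tail y
  vertex-orbit = orbit-least next (λ x y → tail x ≡ tail y) refl
    λ {_} {y} eq → trans eq (sym (next-tail y))

  -- The orbits of `next` are the sets of darts departing from one vertex, and each holds exactly
  -- one dart of `M`.
  matching-odd : ∀ M → IsPerfectMatching M → OddOn next↣ (lookup M ∘ proj₁)
  matching-odd M perfect x with perfect (tail x)
  ... | d , (tail-d , d∈M) , unique = trans
    (total-single _ d λ y y≢d → others y (y≢d ∘ sym) (orbit? next↣ x y))
    (cong₂ _∧_ (dec-true (orbit? next↣ x d) (next-cyclic x d (sym tail-d))) ([]=⇒lookup d∈M))
    where
    others : ∀ y → d ≢ y → (o : Dec (Orbit next x y)) → does o ∧ lookup M (edge y) ≡ false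
    others y d≢y (no _)  = refl
    others y d≢y (yes o) = ¬-not λ y∈M →
      d≢y (unique (sym (vertex-orbit o) , lookup⇒[]= (edge y) M y∈M))

  -- The witness is a dual path between the faces of x and y.
  Linked : Rel Dart 0ℓ
  Linked x y = ∃[ p ] ∀ d → χ trace↣ d · (p ∘ edge) ≡ χ trace↣ d x xor χ trace↣ d y

  -- Paths add in 𝔽₂, and the intermediate face cancels.
  linked-trans : ∀ {x y z} → Linked x y → Linked y z → Linked x z
  linked-trans {x} {y} {z} (p , eqp) (q , eqq) = (λ e → p e xor q e) , λ d →
    trans (·-distribˡ (χ trace↣ d) (p ∘ edge) (q ∘ edge))
      (trans (cong₂ _xor_ (eqp d) (eqq d)) (telescope (χ trace↣ d x) (χ trace↣ d y) (χ trace↣ d z)))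
    where
    telescope : ∀ a b c → (a xor b) xor (b xor c) ≡ a xor c
    telescope a b c = trans (xor-assoc a b (b xor c)) (cong (a xor_)
      (trans (sym (xor-assoc b b c)) (cong (_xor c) (xor-same b))))

  linked-face : ∀ {x y} → Orbit trace x y → Linked x y
  linked-face {x} {y} o = (λ _ → false) , λ d →
    trans (·-zero (χ trace↣ d)) (sym (trans (cong (_xor χ trace↣ d y) (same d)) (xor-same (χ trace↣ d y))))
    where
    same : ∀ d → χ trace↣ d x ≡ χ trace↣ d y
    same d = does-⇔ (mk⇔ (λ dx → orbit-trans trace dx o)
      (λ dy → orbit-trans trace dy (orbit-sym trace↣ o))) (orbit? trace↣ d x) (orbit? trace↣ d y)

  -- The path crosses the edge of `x` only; a face walk meets that edge once for each of its two
  -- darts on the walk.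
  linked-reverse : ∀ x → Linked x (reverse x)
  linked-reverse (i , b) = (λ e → does (i Fin.≟ e)) , λ d → trans
    (·-edgewise (χ trace↣ d) (λ e → does (i Fin.≟ e)))
    (trans (sum-single _ i λ e e≢i → trans
        (cong ((χ trace↣ d (e , false) xor χ trace↣ d (e , true)) ∧_) (dec-false (i Fin.≟ e) (e≢i ∘ sym)))
        (∧-zeroʳ _))
      (trans (cong ((χ trace↣ d (i , false) xor χ trace↣ d (i , true)) ∧_) (dec-true (i Fin.≟ i) refl))
        (trans (∧-identityʳ _) (ordered b d))))
    where
    ordered : ∀ b d → χ trace↣ d (i , false) xor χ trace↣ d (i , true) ≡
      χ trace↣ d (i , b) xor χ trace↣ d (i , not b)
    ordered false d = refl
    ordered true  d = xor-comm (χ trace↣ d (i , false)) (χ trace↣ d (i , true))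

  -- `next y` equals `trace (reverse y)`: cross the edge of `y`, then remain in the face reached.
  linked-next : ∀ {x y} → Orbit next x y → Linked x y
  linked-next = orbit-least next Linked (linked-face (0 , refl)) λ {_} {y} l →
    linked-trans l (linked-trans (linked-reverse y)
      (linked-face (1 , cong next (reverse-involutive y))))

  -- At each vertex of the path, rotate to the dart to be travelled, then cross its edge.
  -- Connectedness thus links any two faces.
  linked-path : ∀ {u v} → Star Adjacent u v → ∀ x y → tail x ≡ u → tail y ≡ v → Linked x y
  linked-path ε x y refl eq = linked-next (next-cyclic x y (sym eq))
  linked-path ((d , refl , refl) ◅ path) x y eq eq′ =
    linked-trans (linked-next (next-cyclic x d eq))
      (linked-trans (linked-reverse d) (linked-path path (reverse d) y refl eq′))

  -- An edge set that meets every face oddly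

  odd-cut : Connected → 2 ∣ #E → ∃ IsPerfectMatching →
    ∃[ T ] (∀ d → χ trace↣ d · (T ∘ edge) ≡ true)
  odd-cut (v₀ , connected) even-#E (M , perfect) = T , λ d → begin
    χ trace↣ d · (T ∘ edge)
      ≡⟨ ·-congˡ (χ trace↣ d) decompose ⟩
    χ trace↣ d · ((w ⊞ ends) ⊞ joins)
      ≡⟨ ·-distribˡ (χ trace↣ d) (w ⊞ ends) joins ⟩
    χ trace↣ d · (w ⊞ ends) xor χ trace↣ d · joins
      ≡⟨ cong₂ _xor_ (·-distribˡ (χ trace↣ d) w ends) (joins-sum d) ⟩
    (χ trace↣ d · w xor χ trace↣ d · ends) xor χ trace↣ d · ends
      ≡⟨ xor-assoc (χ trace↣ d · w) _ _ ⟩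
    χ trace↣ d · w xor (χ trace↣ d · ends xor χ trace↣ d · ends)
      ≡⟨ cong₂ _xor_ (odd d) (xor-same (χ trace↣ d · ends)) ⟩
    true ∎
    where
    open ≡-Reasoning
    -- The dart that matches `v₀` marks the face to which all dual paths lead.
    root : Dart
    root = proj₁ (perfect v₀)

    kasteleyn = Kasteleyn.orientation next↣ (lookup M ∘ edge) (matching-odd M perfect)
      (λ e → xor-same (lookup M e)) trace↣ (λ _ _ → refl)

    w : Dart → Bool
    w = proj₁ kasteleyn
    odd = proj₁ (proj₂ kasteleyn)
    oriented = proj₂ (proj₂ kasteleyn)

    -- Added to `w`, this makes the two darts of every edge agree, since `w` tells them apart.
    ends : Dart → Bool
    ends = proj₂

    -- Adding `ends` disturbs the face sums at the darts `(i , true)`; one dual path for each of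
    -- them makes up for it.
    link : ∀ i → Linked (i , true) root
    link i = linked-path (connected _ _) (i , true) root refl refl

    joins : Dart → Bool
    joins x = sum λ i → proj₁ (link i) (edge x)

    -- Read off at the dart `false`, where `ends` vanishes.
    T : Edge → Bool
    T e = w (e , false) xor joins (e , false)

    decompose : ∀ x → T (edge x) ≡ ((w ⊞ ends) ⊞ joins) x
    decompose (e , false) = cong (_xor joins (e , false)) (sym (xor-identityʳ (w (e , false))))
    decompose (e , true)  = cong (_xor joins (e , false)) (flip-end (w (e , false)) (oriented e))
      where
      flip-end : ∀ a {b} → a xor b ≡ true → a ≡ b xor true
      flip-end false refl = refl
      flip-end true {false} refl = refl

    joins-sum : ∀ d → χ trace↣ d · joins ≡ χ trace↣ d · ends
    joins-sum d = begin
      χ trace↣ d · joins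
        ≡⟨ ·-sum (χ trace↣ d) (λ i → proj₁ (link i) ∘ edge) ⟩
      sum (λ i → χ trace↣ d · (proj₁ (link i) ∘ edge))
        ≡⟨ sum-cong-≗ (λ i → proj₂ (link i) d) ⟩
      sum (λ i → χ trace↣ d (i , true) xor χ trace↣ d root)
        ≡⟨ ∑-distrib-+ (λ i → χ trace↣ d (i , true)) (λ _ → χ trace↣ d root) ⟩
      sum (λ i → χ trace↣ d (i , true)) xor sum {#E} (λ _ → χ trace↣ d root)
        -- All `#E` paths stop at the root, and an even number of equal terms cancels.
        ≡⟨ cong (sum (λ i → χ trace↣ d (i , true)) xor_) (sum-const-even even-#E (χ trace↣ d root)) ⟩
      sum (λ i → χ trace↣ d (i , true)) xor false
        ≡⟨ xor-identityʳ _ ⟩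
      sum (λ i → χ trace↣ d (i , true))
        ≡⟨ sum-cong-≗ (λ i → sym (cong₂ _xor_ (∧-zeroʳ (χ trace↣ d (i , false))) (∧-identityʳ (χ trace↣ d (i , true))))) ⟩
      χ trace↣ d · ends ∎

  -- Bipartition of the resonance graph

  facial-xor : ∀ {M₁ M₂ d} → IsFacialCycle d →
    (∀ e → (e ∈ M₁ ⊕ M₂) ⇔ (∃[ x ] (OnFaceOf d x × edge x ≡ e))) →
    ∀ e → lookup M₁ e xor lookup M₂ e ≡ χ trace↣ d (e , false) xor χ trace↣ d (e , true)
  facial-xor {M₁} {M₂} {d} cycle rotates e
    with orbit? trace↣ d (e , false) | orbit? trace↣ d (e , true)
  -- A cycle repeats no edge, so the two darts of `e` cannot both lie on it; hence the sum on the
  -- right marks exactly the edges of the cycle.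
  ... | yes o | yes o′ = contradiction (proj₂ (cycle o o′) refl) λ ()
  ... | yes o | no _   = trans (sym (lookup-⊕ M₁ M₂ e))
    ([]=⇒lookup (Equivalence.from (rotates e) ((e , false) , o , refl)))
  ... | no _  | yes o  = trans (sym (lookup-⊕ M₁ M₂ e))
    ([]=⇒lookup (Equivalence.from (rotates e) ((e , true) , o , refl)))
  ... | no ¬o | no ¬o′ = trans (sym (lookup-⊕ M₁ M₂ e)) (¬-not λ on →
    case Equivalence.to (rotates e) (lookup⇒[]= e (M₁ ⊕ M₂) on) of λ where
      ((_ , false) , o , refl) → ¬o o
      ((_ , true) , o , refl)  → ¬o′ o)

theorem2p6 : (G : Graph) → Graph.Connected G →
    (h : ℕ) (S : CellularEmbedding G) → CellularEmbedding.HasGenus S h →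
    2 ∣ Graph.#E G →
    ∃ (Graph.IsPerfectMatching G) →
    Bipartite (CellularEmbedding.TotalResonance S)
theorem2p6 G connected h S genus even-#E matching = side , λ {P} {Q} → crosses P Q
  where
  open CellularEmbedding S using (TotalResonance)
  open Graph.PerfectMatching using (edges)
  open Embedding G S
  open DartSums (Graph.#E G) using (χ; _·_; ·-edgewise)

  cut = odd-cut connected even-#E matching
  T = proj₁ cut

  side : Graph.PerfectMatching G → Bool
  side P = sum λ e → lookup (edges P) e ∧ T e

  crosses : ∀ P Q → TotalResonance P Q → side P ≢ side Q
  crosses P Q (d , cycle , rotates) same =
    case trans (sym odd) (trans (cong (_xor side Q) same) (xor-same (side Q))) of λ ()
    where
    open ≡-Reasoning
    -- The sides differ by the number of edges of `T` on the facial cycle, taken mod 2, and the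
    -- choice of `T` makes it odd.
    odd : side P xor side Q ≡ true
    odd = begin
      side P xor side Q
        ≡⟨ sym (∑-distrib-+ (λ e → lookup (edges P) e ∧ T e) (λ e → lookup (edges Q) e ∧ T e)) ⟩
      sum (λ e → (lookup (edges P) e ∧ T e) xor (lookup (edges Q) e ∧ T e))
        ≡⟨ sum-cong-≗ (λ e → trans (sym (∧-distribʳ-xor (T e) (lookup (edges P) e) (lookup (edges Q) e)))
             (cong (_∧ T e) (facial-xor cycle rotates e))) ⟩
      sum (λ e → (χ trace↣ d (e , false) xor χ trace↣ d (e , true)) ∧ T e)
        ≡⟨ sym (·-edgewise (χ trace↣ d) T) ⟩
      χ trace↣ d · (T ∘ proj₁)
        ≡⟨ proj₂ cut d ⟩
      true ∎
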